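{- Let $G$ be a connected graph, let $M \subseteq V(G)$ be a longest path transversal of $G$, and let $D \subseteq M$ be a connected dominating set of $G[M]$. Let $C_1,\dots,C_t$ be the connected components of $G \setminus M$, and let $C_{\max}$ be a path-maximal component with respect to $M$. Let $S \subseteq M$ be a set that dominates $\mathsf{bd}(C_{\max},M)$. Then $D \cup S$ is a longest path transversal of $G$.
   Context: All graphs are finite, simple. A longest path of a connected graph $G$ is a path of maximum length (number of edges) in $G$. A longest path transversal of $G$ is a set $S \subseteq V(G)$ such that every longest path of $G$ contains at least one vertex of $S$. For $X,Y\subseteq V(G)$, $\mathsf{bd}(X,Y)=\{x\in X : x \text{ has a neighbor in } Y\}$. A set $D$ is a connected dominating set of a graph $F$ if $F[D]$ is connected and every vertex of $F$ is in $D$ or adjacent to a vertex of $D$; a set $S$ dominates a set $Z$ if every vertex of $Z$ is in $S$ or has a neighbor in $S$. Given $M\subseteq V(G)$ and the components $C_1,\dots,C_t$ of $G\setminus M$, let $t_i$ be the length of a longest path of $G[C_i]$ having at least one endpoint in $\mathsf{bd}(C_i,M)$; a component $C_{\max}$ is path-maximal with respect to $M$ if $t_{\max}\ge t_i$ for all $1\le i\le t$. -}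

module Defs where

open import Data.Fin using (Fin)
open import Data.Fin.Subset using (Subset; _∈_; _⊆_; _∩_; _─_; Nonempty)
open import Data.Fin.Subset.Properties using (_∈?_; x∈p∩q⁺)
open import Data.List using (List; []; length; head; last)
open import Data.List.Relation.Unary.All using (All)
open import Data.List.Relation.Unary.Any using (Any)
open import Data.List.Relation.Unary.Linked using (Linked)
open import Data.List.Relation.Unary.Unique.Propositional using (Unique)
open import Data.Maybe using (just)
open import Data.Nat using (ℕ; pred; _≤_)
open import Data.Product using (∃-syntax; _×_; _,_)
open import Data.Sum using (_⊎_)
open import Level using (0ℓ)
open import Relation.Binary using (Rel; Symmetric; Decidable)
open import Relation.Binary.PropositionalEquality using (_≡_; _≢_)
open import Relation.Nullary using (¬_)
open import Relation.Nullary.Decidable using (_×-dec_)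
open import Relation.Unary using (Pred)

-- A finite simple graph whose vertex set is a subset of Fin n.  Allowing a
-- proper subset lets a graph and its induced subgraphs share the type
-- Graph n.  Adjacency is decidable, as it always is classically.
record Graph (n : ℕ) : Set₁ where
  infix 4 _~_ _~?_
  field
    V      : Subset n
    _~_    : Rel (Fin n) 0ℓ
    _~?_   : Decidable _~_
    ~-sym  : Symmetric _~_
    ~-irr  : ∀ {u} → ¬ (u ~ u)
    ~⇒∈V   : ∀ {u v} → u ~ v → u ∈ V

open Graph using (V)

module _ {n : ℕ} where

  infixl 8 _[_] _∖_

  _[_] : Graph n → Subset n → Graph n
  G [ X ] = record
    { V     = V G ∩ X
    ; _~_   = λ u v → u ∈ X × v ∈ X × u ~ v
    ; _~?_  = λ u v → (u ∈? X) ×-dec (v ∈? X) ×-dec (u ~? v)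
    ; ~-sym = λ (u∈X , v∈X , e) → v∈X , u∈X , ~-sym e
    ; ~-irr = λ (_ , _ , e) → ~-irr e
    ; ~⇒∈V  = λ (u∈X , _ , e) → x∈p∩q⁺ (~⇒∈V e , u∈X)
    }
    where open Graph G using (_~_; _~?_; ~-sym; ~-irr; ~⇒∈V)

  _∖_ : Graph n → Subset n → Graph n
  G ∖ M = G [ V G ─ M ]

  -- A path is given by the list of its vertices in order; single-vertex
  -- paths are allowed.
  record IsPath (G : Graph n) (p : List (Fin n)) : Set where
    open Graph G using (_~_)
    field
      nonempty : p ≢ []
      inV      : All (_∈ V G) p
      linked   : Linked _~_ p
      distinct : Unique p

  -- The number of edges.
  pathLength : List (Fin n) → ℕ
  pathLength p = pred (length p)

  IsEndpoint : Fin n → List (Fin n) → Set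
  IsEndpoint x p = head p ≡ just x ⊎ last p ≡ just x

  record IsLongestPath (G : Graph n) (p : List (Fin n)) : Set where
    field
      isPath  : IsPath G p
      longest : ∀ q → IsPath G q → pathLength q ≤ pathLength p

  record IsLongestPathTransversal (G : Graph n) (S : Subset n) : Set where
    field
      ⊆V   : S ⊆ V G
      hits : ∀ p → IsLongestPath G p → Any (_∈ S) p

  record Connected (G : Graph n) : Set where
    field
      nonempty : Nonempty (V G)
      joined   : ∀ {u v} → u ∈ V G → v ∈ V G →
                 ∃[ p ] IsPath G p × head p ≡ just u × last p ≡ just v

  record IsComponent (G : Graph n) (C : Subset n) : Set where
    field
      ⊆V        : C ⊆ V G
      connected : Connected (G [ C ])
      maximal   : ∀ {C′} → C′ ⊆ V G → Connected (G [ C′ ]) → C ⊆ C′ → C′ ⊆ C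

  bd : Graph n → Subset n → Subset n → Pred (Fin n) 0ℓ
  bd G X Y x = x ∈ X × ∃[ y ] y ∈ Y × x ~ y
    where open Graph G using (_~_)

  Dominates : Graph n → Subset n → Pred (Fin n) 0ℓ → Set
  Dominates G S Z = ∀ {z} → Z z → z ∈ S ⊎ (∃[ s ] s ∈ S × z ~ s)
    where open Graph G using (_~_)

  record IsConnectedDominatingSet (F : Graph n) (D : Subset n) : Set where
    field
      ⊆V         : D ⊆ V F
      connected  : Connected (F [ D ])
      dominating : Dominates F D (_∈ V F)

  record IsBoundaryPath (G : Graph n) (M C : Subset n) (p : List (Fin n)) : Set where
    field
      isPath   : IsPath (G [ C ]) p
      boundary : ∃[ x ] IsEndpoint x p × bd G C M x

  -- IsBoundaryPathLength G M Cᵢ t says that t = tᵢ, the length of a longest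
  -- path of G[Cᵢ] with at least one endpoint in bd(Cᵢ, M).
  record IsBoundaryPathLength (G : Graph n) (M C : Subset n) (t : ℕ) : Set where
    field
      attained : ∃[ p ] IsBoundaryPath G M C p × pathLength p ≡ t
      bound    : ∀ p → IsBoundaryPath G M C p → pathLength p ≤ t

  -- tᵢ exists exactly when bd(Cᵢ, M) is nonempty, which holds for every
  -- component if G is connected and M meets V(G).
  record IsPathMaximal (G : Graph n) (M Cmax : Subset n) : Set where
    field
      component : IsComponent (G ∖ M) Cmax
      maximal   : ∀ {tmax} → IsBoundaryPathLength G M Cmax tmax →
                  ∀ {C t} → IsComponent (G ∖ M) C →
                  IsBoundaryPathLength G M C t → t ≤ tmax

{-# OPTIONS --safe #-}
-- T = D ∪ S is connected and every vertex outside T that lies in M or in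
-- bd(Cmax, M) has a neighbour in T.  Let a longest path p = as ++ w ∷ bs miss T,
-- where w has a neighbour in T.  A path q disjoint from T and from w ∷ bs whose
-- last vertex has a neighbour in T can be joined to w ∷ bs through T, so q has
-- fewer vertices than as.  Taking q = as shows that no two consecutive vertices
-- of p both have a neighbour in T, hence p never crosses between M and Cmax and
-- so avoids Cmax.  Let w be the first vertex of p in M; then as is nonempty (q = []),
-- and it is a boundary path of some component.  Taking for q a longest boundary
-- path of Cmax contradicts path-maximality.
--
-- Components and the numbers tᵢ are only shown to be not non-existent, which
-- suffices because meeting T is decidable.

module Submission where

open import Defs
open import Data.Nat using (ℕ)
open import Data.Fin.Subset using (Subset; _⊆_; _∪_)

open import Data.Empty using (⊥)
open import Data.Fin using (Fin; zero; suc)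
open import Data.Fin.Properties using (_≟_)
open import Data.Fin.Subset using (_∈_; _∉_; _─_; ⁅_⁆; ∣_∣; inside; outside)
open import Data.Fin.Subset.Properties
  using (_∈?_; x∈p∩q⁺; x∈p∩q⁻; x∈p∪q⁻; p⊆p∪q; q⊆p∪q; x∈⁅x⁆; x∈⁅y⁆⇒x≡y; ∣p∣≤n;
         p⊂q⇒∣p∣<∣q∣; x∈p∧x∉q⇒x∈p─q)
open import Data.List using (List; []; _∷_; _++_; length; head; last; reverse)
open import Data.List.Membership.DecPropositional using () renaming (_∈?_ to mem?)
open import Data.List.Membership.Propositional using () renaming (_∈_ to _∈ˡ_)
open import Data.List.Membership.Propositional.Properties using (∈-∃++; ∈-++⁻)
open import Data.List.Properties
  using (++-assoc; ++-conicalʳ; length-++; length-reverse; unfold-reverse)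
open import Data.List.Relation.Binary.Disjoint.Propositional using (Disjoint)
open import Data.List.Relation.Binary.Permutation.Propositional using (↭-sym; ↭⇒↭ₛ)
open import Data.List.Relation.Binary.Permutation.Propositional.Properties
  using (↭-reverse; All-resp-↭)
import Data.List.Relation.Binary.Permutation.Setoid.Properties as Permutation
open import Data.List.Relation.Unary.All as All using (All; []; _∷_)
import Data.List.Relation.Unary.All.Properties as All
open import Data.List.Relation.Unary.AllPairs using ([]; _∷_)
open import Data.List.Relation.Unary.Any using (Any; here; there; any?)
import Data.List.Relation.Unary.First as First
open import Data.List.Relation.Unary.First.Properties using (toView)
open import Data.List.Relation.Unary.Linked as Linked using (Linked; []; [-]; _∷_)
import Data.List.Relation.Unary.Linked.Properties as Linked
open import Data.List.Relation.Unary.Unique.Propositional using (Unique)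
import Data.List.Relation.Unary.Unique.Propositional.Properties as Unique
open import Data.Maybe using (just; nothing)
open import Data.Maybe.Properties using (just-injective)
open import Data.Maybe.Relation.Binary.Connected as Link
  using (just; just-nothing; nothing-just; nothing) renaming (Connected to Link)
open import Data.Nat using (zero; suc; _+_; _≤_; _<_; z≤n; s≤s)
open import Data.Nat.Properties
  using (≤-trans; ≤-reflexive; m≤m+n; +-suc; +-assoc; +-monoʳ-≤; +-cancelʳ-≤; ≮⇒≥; <⇒≱;
         <-irrefl; module ≤-Reasoning)
open import Data.Product using (∃-syntax; _×_; _,_; proj₁; proj₂)
open import Data.Sum as Sum using (_⊎_; inj₁; inj₂)
open import Data.Vec using (_∷_; here; there)
open import Function using (_∘_)
open import Level using (0ℓ)
open import Relation.Binary using (Rel; Symmetric)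
open import Relation.Binary.Construct.Closure.ReflexiveTransitive as Star
  using (Star; ε; _◅_; _◅◅_)
open import Relation.Binary.PropositionalEquality
  using (_≡_; _≢_; refl; sym; trans; cong; subst; setoid)
open import Relation.Nullary using (¬_; yes; no; contradiction)
open import Relation.Nullary.Decidable using (decidable-stable; toSum)

-- Maxima of bounded functions, up to double negation.

module _ {A : Set} (P : A → Set) (f : A → ℕ) (b : ℕ) (f≤b : ∀ {a} → P a → f a ≤ b) where

  IsMaximum : A → Set
  IsMaximum a = P a × (∀ {a′} → P a′ → f a′ ≤ f a)

  -- Induction on a bound `d` for the gap between `b` and `f a`. At gap zero `a` is already a
  -- maximum; otherwise any element with a larger value has a smaller gap and is refuted by
  -- induction, so `a` would be a maximum. Since `P` need not be decidable, the maximum is obtained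
  -- only under a double negation.
  ¬¬-maximum : ∀ {a} → P a → ¬ ¬ (∃[ a ] IsMaximum a)
  ¬¬-maximum {a} pa ∄max = climb b pa (m≤m+n b (f a))
    where
    climb : ∀ d {a} → P a → b ≤ d + f a → ⊥
    climb zero    pa b≤fa = ∄max (_ , pa , λ pa′ → ≤-trans (f≤b pa′) b≤fa)
    climb (suc d) {a} pa b≤1+d+fa = ∄max (a , pa , λ pa′ → ≮⇒≥ λ fa<fa′ →
      climb d pa′ (≤-trans b≤1+d+fa
        (≤-trans (≤-reflexive (sym (+-suc d (f a)))) (+-monoʳ-≤ d fa<fa′))))

x∈p─q⇒x∉q : ∀ {n} {p q : Subset n} {x : Fin n} → x ∈ p ─ q → x ∉ q
x∈p─q⇒x∉q {p = _ ∷ p} {inside ∷ q}  {zero}  ()            here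
x∈p─q⇒x∉q {p = _ ∷ p} {inside ∷ q}  {suc x} (there x∈p─q) (there x∈q) = x∈p─q⇒x∉q x∈p─q x∈q
x∈p─q⇒x∉q {p = _ ∷ p} {outside ∷ q} {suc x} (there x∈p─q) (there x∈q) = x∈p─q⇒x∉q x∈p─q x∈q

-- The predecessor sends the lengths 0 and 1 to the same value, so an empty `p` has to be excluded.
pathLength⇒length : ∀ {n} (q p : List (Fin n)) → p ≢ [] →
                    pathLength q ≤ pathLength p → length q ≤ length p
pathLength⇒length _       []      p≢[] _  = contradiction refl p≢[]
pathLength⇒length []      (_ ∷ _) _    _  = z≤n
pathLength⇒length (_ ∷ _) (_ ∷ _) _    le = s≤s le

-- Lists: last elements, reversal, splitting and linked lists.

module _ {A : Set} where

  last-++-∷ : ∀ (xs : List A) y ys → last (xs ++ y ∷ ys) ≡ last (y ∷ ys)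
  last-++-∷ []           y ys = refl
  last-++-∷ (_ ∷ [])     y ys = refl
  last-++-∷ (_ ∷ x ∷ xs) y ys = last-++-∷ (x ∷ xs) y ys

  last-∷ : ∀ (x : A) xs → ∃[ z ] last (x ∷ xs) ≡ just z
  last-∷ x []       = x , refl
  last-∷ x (y ∷ ys) = last-∷ y ys

  last-reverse : ∀ (xs : List A) → last (reverse xs) ≡ head xs
  last-reverse []       = refl
  last-reverse (x ∷ xs) =
    trans (cong last (unfold-reverse x xs)) (last-++-∷ (reverse xs) x [])

  last⇒∈ : ∀ xs {x : A} → last xs ≡ just x → x ∈ˡ xs
  last⇒∈ (x ∷ [])     refl = here refl
  last⇒∈ (_ ∷ y ∷ xs) eq   = there (last⇒∈ (y ∷ xs) eq)

  Unique-reverse : ∀ {xs : List A} → Unique xs → Unique (reverse xs)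
  Unique-reverse {xs} = Permutation.Unique-resp-↭ (setoid A) (↭⇒↭ₛ (↭-sym (↭-reverse xs)))

  Unique-++⁻ : ∀ (xs : List A) {ys} → Unique (xs ++ ys) → Unique xs × Unique ys × Disjoint xs ys
  Unique-++⁻ []       uys        = [] , uys , λ ()
  Unique-++⁻ (x ∷ xs) (x∉ ∷ uxs) with Unique-++⁻ xs uxs
  ... | ux , uy , disjoint = All.++⁻ˡ xs x∉ ∷ ux , uy , λ where
    (here refl , v∈ys) → All.lookup (All.++⁻ʳ xs x∉) v∈ys refl
    (there v∈xs , v∈ys) → disjoint (v∈xs , v∈ys)

  module _ {P : A → Set} where

    -- From the one element known to satisfy `P`, the property spreads along the links in both
    -- directions. This is how a path that never crosses the border of a vertex set is confined to
    -- that set once it meets it.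
    Linked-stable⇒All : ∀ {xs} → Linked (λ u w → (P u → P w) × (P w → P u)) xs →
                        Any P xs → All P xs
    Linked-stable⇒All [-]                     (here px) = px ∷ []
    Linked-stable⇒All ((u⇒w , _) ∷ links)     (here pu) =
      pu ∷ Linked-stable⇒All links (here (u⇒w pu))
    Linked-stable⇒All ((_ , w⇒u) ∷ links)     (there p) with Linked-stable⇒All links p
    ... | pw ∷ pws = w⇒u pw ∷ pw ∷ pws

  module _ {R : Rel A 0ℓ} where

    Linked-reverse : Symmetric R → ∀ {xs} → Linked R xs → Linked R (reverse xs)
    Linked-reverse R-sym {[]}     []   = []
    Linked-reverse R-sym {x ∷ xs} rxxs = subst (Linked R) (sym (unfold-reverse x xs))
      (Linked.++⁺ (Linked-reverse R-sym (Linked.tail rxxs))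
        (subst (λ l → Link R l (just x)) (sym (last-reverse xs))
          (Link.sym R-sym (Linked.head′ rxxs)))
        [-])

    Linked-++⁻ : ∀ xs {ys} → Linked R (xs ++ ys) →
                 Linked R xs × Link R (last xs) (head ys) × Linked R ys
    Linked-++⁻ []           {[]}    rys         = [] , nothing , rys
    Linked-++⁻ []           {_ ∷ _} rys         = [] , nothing-just , rys
    Linked-++⁻ (_ ∷ [])     {[]}    _           = [-] , just-nothing , []
    Linked-++⁻ (_ ∷ [])     {_ ∷ _} (r ∷ rys)   = [-] , just r , rys
    Linked-++⁻ (_ ∷ x ∷ xs)         (r ∷ rxsys) with Linked-++⁻ (x ∷ xs) rxsys
    ... | rxs , link , rys = r ∷ rxs , link , rys

    Linked-++-∷⁻ : ∀ xs {u w ys} → Linked R (xs ++ u ∷ w ∷ ys) → R u w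
    Linked-++-∷⁻ xs rs = Linked.head (proj₂ (proj₂ (Linked-++⁻ xs rs)))

    -- The argument `r` learns where in `xs` the pair stands, because rerouting arguments need the
    -- whole list around two consecutive vertices.
    Linked-tabulate : ∀ xs → (∀ as {u w} bs → xs ≡ as ++ u ∷ w ∷ bs → R u w) → Linked R xs
    Linked-tabulate []           r = []
    Linked-tabulate (_ ∷ [])     r = [-]
    Linked-tabulate (x ∷ y ∷ xs) r =
      r [] xs refl ∷ Linked-tabulate (y ∷ xs) λ as bs eq → r (x ∷ as) bs (cong (x ∷_) eq)

    Linked⇒Star : ∀ {x y} xs → Linked R (x ∷ xs) → last (x ∷ xs) ≡ just y → Star R x y
    Linked⇒Star []       _        refl = ε
    Linked⇒Star (_ ∷ xs) (r ∷ rs) eq   = r ◅ Linked⇒Star xs rs eq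

    -- With membership in `X` for `P`, the resulting relation is adjacency in `G [ X ]`.
    Linked-restrict : ∀ {P : A → Set} {xs} → All P xs → Linked R xs →
                      Linked (λ u w → P u × P w × R u w) xs
    Linked-restrict _              []       = []
    Linked-restrict _              [-]      = [-]
    Linked-restrict (pu ∷ pw ∷ ps) (r ∷ rs) = (pu , pw , r) ∷ Linked-restrict (pw ∷ ps) rs

-- Paths under concatenation, reversal and passage to induced subgraphs.

module _ {n : ℕ} where

  -- Unlike IsPath, this allows the empty list.
  record IsPath₀ (G : Graph n) (p : List (Fin n)) : Set where
    constructor mkPath₀
    open Graph G using (V; _~_)
    field
      inV      : All (_∈ V) p
      linked   : Linked _~_ p
      distinct : Unique p

  module _ {G : Graph n} where
    open Graph G using (V; _~_; ~-sym)

    fromPath : ∀ {p} → IsPath G p → IsPath₀ G p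
    fromPath path = mkPath₀ inV linked distinct
      where open IsPath path

    toPath : ∀ {p} → p ≢ [] → IsPath₀ G p → IsPath G p
    toPath p≢[] (mkPath₀ inV linked distinct) = record
      { nonempty = p≢[] ; inV = inV ; linked = linked ; distinct = distinct }

    Path₀-++⁺ : ∀ {p q} → IsPath₀ G p → IsPath₀ G q → Disjoint p q →
                Link _~_ (last p) (head q) → IsPath₀ G (p ++ q)
    Path₀-++⁺ (mkPath₀ vp lp up) (mkPath₀ vq lq uq) disjoint link =
      mkPath₀ (All.++⁺ vp vq) (Linked.++⁺ lp link lq) (Unique.++⁺ up uq disjoint)

    Path₀-++⁻ : ∀ p {q} → IsPath₀ G (p ++ q) →
                IsPath₀ G p × IsPath₀ G q × Disjoint p q × Link _~_ (last p) (head q)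
    Path₀-++⁻ p (mkPath₀ v l u) with Linked-++⁻ p l | Unique-++⁻ p u
    ... | lp , link , lq | up , uq , disjoint =
      mkPath₀ (All.++⁻ˡ p v) lp up , mkPath₀ (All.++⁻ʳ p v) lq uq , disjoint , link

    Path₀-reverse : ∀ {p} → IsPath₀ G p → IsPath₀ G (reverse p)
    Path₀-reverse {p} (mkPath₀ v l u) =
      mkPath₀ (All-resp-↭ (↭-sym (↭-reverse p)) v) (Linked-reverse ~-sym l) (Unique-reverse u)

    Path₀-[]⁺ : ∀ {X p} → All (_∈ X) p → IsPath₀ G p → IsPath₀ (G [ X ]) p
    Path₀-[]⁺ p⊆X (mkPath₀ v l u) =
      mkPath₀ (All.zipWith x∈p∩q⁺ (v , p⊆X)) (Linked-restrict p⊆X l) u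

    Path₀-[]⁻ : ∀ {X p} → IsPath₀ (G [ X ]) p → All (_∈ X) p × IsPath₀ G p
    Path₀-[]⁻ {X} (mkPath₀ v l u) =
      All.map (proj₂ ∘ x∈p∩q⁻ V X) v ,
      mkPath₀ (All.map (proj₁ ∘ x∈p∩q⁻ V X) v) (Linked.map (proj₂ ∘ proj₂) l) u

  -- Walks and connectedness.

  module _ (G : Graph n) where
    open Graph G using (V; _~_; ~-sym; ~⇒∈V)

    -- Loop erasure.
    Star⇒Path : ∀ {u v} → u ∈ V → Star _~_ u v →
                ∃[ p ] IsPath₀ G (u ∷ p) × last (u ∷ p) ≡ just v
    Star⇒Path u∈V ε = [] , mkPath₀ (u∈V ∷ []) [-] ([] ∷ []) , refl
    Star⇒Path {u} u∈V (_◅_ {j = w} u~w walk) with Star⇒Path (~⇒∈V (~-sym u~w)) walk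
    ... | p , path , eq with mem? _≟_ u (w ∷ p)
    ...   | no u∉ = w ∷ p , Path₀-++⁺ (mkPath₀ (u∈V ∷ []) [-] ([] ∷ [])) path
                              (λ { (here refl , u∈) → u∉ u∈ }) (just u~w) , eq
    ...   | yes u∈ with ∈-∃++ u∈
    ...     | as , bs , split = bs ,
      proj₁ (proj₂ (Path₀-++⁻ as (subst (IsPath₀ G) split path))) ,
      trans (sym (last-++-∷ as u bs)) (trans (cong last (sym split)) eq)

    Connected⇒Star : Connected G → ∀ {u v} → u ∈ V → v ∈ V → Star _~_ u v
    Connected⇒Star conn u∈V v∈V with Connected.joined conn u∈V v∈V
    ... | _ ∷ p , path , refl , eq = Linked⇒Star p (IsPath.linked path) eq

    -- Any two vertices are joined by a walk through the hub `u`, which `Star⇒Path` shortens to a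
    -- path.
    hub⇒Connected : ∀ {u} → u ∈ V → (∀ {v} → v ∈ V → Star _~_ u v) → Connected G
    hub⇒Connected u∈V reach = record
      { nonempty = _ , u∈V
      ; joined   = λ v∈V w∈V → join (Star⇒Path v∈V (Star.reverse ~-sym (reach v∈V) ◅◅ reach w∈V))
      }
      where
      join : ∀ {v w} → ∃[ p ] IsPath₀ G (v ∷ p) × last (v ∷ p) ≡ just w →
             ∃[ p ] IsPath G p × head p ≡ just v × last p ≡ just w
      join (p , path , eq) = _ ∷ p , toPath (λ ()) path , refl , eq

  -- Components.

  module _ (G : Graph n) where
    open Graph G using (V; _~_; ~-sym; ~⇒∈V)

    -- Adding `w` to `C` keeps the set connected, with `u` as hub, so maximality of `C` already puts
    -- `w` inside.
    component-closed : ∀ {C} → IsComponent G C → ∀ {u w} → u ∈ C → u ~ w → w ∈ C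
    component-closed {C} comp {u} {w} u∈C u~w =
      maximal C+w⊆V (hub⇒Connected (G [ C+w ]) (x∈p∩q⁺ (⊆V u∈C , C⊆C+w u∈C)) reach) C⊆C+w w∈C+w
      where
      open IsComponent comp

      C+w : Subset n
      C+w = C ∪ ⁅ w ⁆

      C⊆C+w : C ⊆ C+w
      C⊆C+w = p⊆p∪q ⁅ w ⁆

      w∈C+w : w ∈ C+w
      w∈C+w = q⊆p∪q C ⁅ w ⁆ (x∈⁅x⁆ w)

      C+w⊆V : C+w ⊆ V
      C+w⊆V x∈ with x∈p∪q⁻ C ⁅ w ⁆ x∈
      ... | inj₁ x∈C = ⊆V x∈C
      ... | inj₂ x∈w with x∈⁅y⁆⇒x≡y w x∈w
      ...   | refl = ~⇒∈V (~-sym u~w)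

      reach : ∀ {v} → v ∈ Graph.V (G [ C+w ]) → Star (Graph._~_ (G [ C+w ])) u v
      reach v∈ with x∈p∪q⁻ C ⁅ w ⁆ (proj₂ (x∈p∩q⁻ V C+w v∈))
      ... | inj₁ v∈C = Star.map (λ (x∈C , y∈C , x~y) → C⊆C+w x∈C , C⊆C+w y∈C , x~y)
                         (Connected⇒Star (G [ C ]) connected
                           (x∈p∩q⁺ (⊆V u∈C , u∈C)) (x∈p∩q⁺ (⊆V v∈C , v∈C)))
      ... | inj₂ v∈w with x∈⁅y⁆⇒x≡y w v∈w
      ...   | refl = (C⊆C+w u∈C , w∈C+w , u~w) ◅ ε

    -- Among the connected sets containing `v`, of which the singleton is one, a set of maximum
    -- cardinality is also maximal under inclusion, since a proper superset would have more
    -- elements.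
    ¬¬-component : ∀ {v} → v ∈ V → ¬ ¬ (∃[ C ] IsComponent G C × v ∈ C)
    ¬¬-component {v} v∈V ∄comp =
      ¬¬-maximum IsConnectedWith ∣_∣ n (λ {C} _ → ∣p∣≤n C) singleton λ where
        (C , (C⊆V , connected , v∈C) , maximum) → ∄comp (C , record
          { ⊆V        = C⊆V
          ; connected = connected
          ; maximal   = λ C′⊆V connected′ C⊆C′ {x} x∈C′ →
              decidable-stable (x ∈? C) λ x∉C →
                <⇒≱ (p⊂q⇒∣p∣<∣q∣ (C⊆C′ , x , x∈C′ , x∉C))
                    (maximum (C′⊆V , connected′ , C⊆C′ v∈C))
          } , v∈C)
      where
      IsConnectedWith : Subset n → Set
      IsConnectedWith C = C ⊆ V × Connected (G [ C ]) × v ∈ C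

      singleton : IsConnectedWith ⁅ v ⁆
      singleton =
        (λ x∈ → subst (_∈ V) (sym (x∈⁅y⁆⇒x≡y v x∈)) v∈V) ,
        hub⇒Connected (G [ ⁅ v ⁆ ]) (x∈p∩q⁺ (v∈V , x∈⁅x⁆ v))
          (λ w∈ → subst (Star _ v)
            (sym (x∈⁅y⁆⇒x≡y v (proj₂ (x∈p∩q⁻ V ⁅ v ⁆ w∈)))) ε) ,
        x∈⁅x⁆ v

  -- Connectedness of a dominated union.

  module _ (G : Graph n) where
    open Graph G using (V; _~_; ~-sym; ~⇒∈V)

    -- A vertex `d` of `D` serves as hub: it reaches all of `D` inside `D`, and a vertex of `S` lies
    -- in `M`, hence is in `D` or one edge away from it.
    ∪-dominated-connected : ∀ {M D S} → D ⊆ M → S ⊆ M →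
                            IsConnectedDominatingSet (G [ M ]) D → Connected (G [ D ∪ S ])
    ∪-dominated-connected {M} {D} {S} D⊆M S⊆M domD with Connected.nonempty connected
      where open IsConnectedDominatingSet domD
    ... | d , d∈ = hub⇒Connected (G [ D ∪ S ])
      (x∈p∩q⁺ (proj₁ (x∈p∩q⁻ V M (proj₁ (x∈p∩q⁻ _ D d∈))) , D⊆D∪S (proj₂ (x∈p∩q⁻ _ D d∈))))
      reach
      where
      open IsConnectedDominatingSet domD

      D⊆D∪S : D ⊆ D ∪ S
      D⊆D∪S = p⊆p∪q S

      reachD : ∀ {v} → v ∈ D → Star (Graph._~_ (G [ D ∪ S ])) d v
      reachD v∈D = Star.map (λ (x∈D , y∈D , _ , _ , x~y) → D⊆D∪S x∈D , D⊆D∪S y∈D , x~y)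
        (Connected⇒Star (G [ M ] [ D ]) connected d∈ (x∈p∩q⁺ (⊆V v∈D , v∈D)))

      reach : ∀ {v} → v ∈ Graph.V (G [ D ∪ S ]) → Star (Graph._~_ (G [ D ∪ S ])) d v
      reach v∈ with x∈p∩q⁻ V (D ∪ S) v∈
      ... | v∈V , v∈D∪S with x∈p∪q⁻ D S v∈D∪S
      ...   | inj₁ v∈D = reachD v∈D
      ...   | inj₂ v∈S with dominating (x∈p∩q⁺ (v∈V , S⊆M v∈S))
      ...     | inj₁ v∈D = reachD v∈D
      ...     | inj₂ (e , e∈D , _ , _ , v~e) =
        reachD e∈D ◅◅ (D⊆D∪S e∈D , v∈D∪S , ~-sym v~e) ◅ ε

    -- Rerouting a longest path through a connected set.

    Sees : Subset n → Fin n → Set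
    Sees T v = ∃[ s ] s ∈ T × v ~ s

    module _ {T p} (T⊆V : T ⊆ V) (T-connected : Connected (G [ T ]))
             (longestPath : IsLongestPath G p) (p∩T≡∅ : All (_∉ T) p) where
      open IsLongestPath longestPath

      -- Otherwise replacing as by q followed by a path inside T lengthens p.
      detour : ∀ {as w bs q} → p ≡ as ++ w ∷ bs → Sees T w →
               IsPath₀ G q → All (_∉ T) q → Disjoint q (w ∷ bs) →
               (∀ {z} → last q ≡ just z → Sees T z) → length q < length as
      detour {as} {w} {bs} {q} refl (t , t∈T , w~t) q-path q∩T≡∅ q∩tail≡∅ last-sees
        with entry (last q) last-sees
        where
        entry : ∀ l → (∀ {z} → l ≡ just z → Sees T z) → ∃[ s ] s ∈ T × Link _~_ l (just s)
        -- An empty `q` has no last vertex to attach to, so the path inside `T` may start anywhere;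
        -- `t` is at hand.
        entry nothing  _    = t , t∈T , nothing-just
        entry (just z) sees with sees refl
        ... | s , s∈T , z~s = s , s∈T , just z~s
      ... | s , s∈T , link with Star⇒Path (G [ T ]) (x∈p∩q⁺ (T⊆V s∈T , s∈T))
                                  (Connected⇒Star (G [ T ]) T-connected
                                    (x∈p∩q⁺ (T⊆V s∈T , s∈T)) (x∈p∩q⁺ (T⊆V t∈T , t∈T)))
      ...   | r , r-path , r-last = begin
        -- The inserted path `s ∷ r` has at least one vertex, which makes the inequality strict.
        suc (length q)             ≤⟨ s≤s (m≤m+n (length q) (length r)) ⟩
        suc (length q + length r)  ≡⟨ +-suc (length q) (length r) ⟨
        length q + suc (length r)  ≤⟨ +-cancelʳ-≤ (suc (length bs)) _ _ total ⟩
        length as                  ∎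
        where
        open ≤-Reasoning

        r⊆T : All (_∈ T) (s ∷ r)
        r⊆T = proj₁ (Path₀-[]⁻ r-path)

        detoured : IsPath₀ G (q ++ (s ∷ r) ++ w ∷ bs)
        detoured = Path₀-++⁺ q-path
          (Path₀-++⁺ (proj₂ (Path₀-[]⁻ r-path)) (proj₁ (proj₂ (Path₀-++⁻ as (fromPath isPath))))
            (λ (v∈r , v∈tail) →
              All.lookup (All.++⁻ʳ as p∩T≡∅) v∈tail (All.lookup r⊆T v∈r))
            (subst (λ l → Link _~_ l (just w)) (sym r-last) (just (~-sym w~t))))
          (λ (v∈q , v∈) → case-∈ v∈q (∈-++⁻ (s ∷ r) v∈))
          link
          where
          case-∈ : ∀ {v} → v ∈ˡ q → v ∈ˡ s ∷ r ⊎ v ∈ˡ w ∷ bs → ⊥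
          case-∈ v∈q (inj₁ v∈r)    = All.lookup q∩T≡∅ v∈q (All.lookup r⊆T v∈r)
          case-∈ v∈q (inj₂ v∈tail) = q∩tail≡∅ (v∈q , v∈tail)

        nonempty : q ++ (s ∷ r) ++ w ∷ bs ≢ []
        nonempty eq with ++-conicalʳ q _ eq
        ... | ()

        total : length q + suc (length r) + suc (length bs) ≤ length as + suc (length bs)
        total = begin
          length q + suc (length r) + suc (length bs)    ≡⟨ +-assoc (length q) _ _ ⟩
          length q + (suc (length r) + suc (length bs))  ≡⟨ cong (length q +_) (length-++ (s ∷ r)) ⟨
          length q + length ((s ∷ r) ++ w ∷ bs)          ≡⟨ length-++ q ⟨
          length (q ++ (s ∷ r) ++ w ∷ bs)
            ≤⟨ pathLength⇒length (q ++ (s ∷ r) ++ w ∷ bs) p (IsPath.nonempty isPath)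
                 (longest _ (toPath nonempty detoured)) ⟩
          length (as ++ w ∷ bs)                          ≡⟨ length-++ as ⟩
          length as + suc (length bs)                    ∎

      -- A neighbour of `w` in `T` could be put in front of `p`. Formally, `detour` with both `as`
      -- and `q` empty yields 0 < 0.
      head-unseen : ∀ {w bs} → p ≡ w ∷ bs → ¬ Sees T w
      head-unseen p≡ w-sees
        with detour {as = []} {q = []} p≡ w-sees (mkPath₀ [] [] []) [] (λ ()) (λ ())
      ... | ()

      -- A path inside `T` could be inserted between `u` and `w`. Formally, `detour` is applied with
      -- the prefix ending in `u` as both the replaced part and its replacement.
      consecutive-unseen : ∀ as {u w bs} → p ≡ as ++ u ∷ w ∷ bs → Sees T u → ¬ Sees T w
      consecutive-unseen as {u} {w} {bs} refl u-sees w-sees =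
        let prefix , _ , disjoint , _ = Path₀-++⁻ (as ++ u ∷ [])
              (subst (IsPath₀ G) split (fromPath isPath)) in
        <-irrefl refl (detour split w-sees prefix
          (All.++⁻ˡ (as ++ u ∷ []) (subst (All (_∉ T)) split p∩T≡∅)) disjoint
          λ last≡z → subst (Sees T) (just-injective (trans (sym (last-++-∷ as u [])) last≡z)) u-sees)
        where
        split : p ≡ (as ++ u ∷ []) ++ w ∷ bs
        split = sym (++-assoc as (u ∷ []) (w ∷ bs))

    -- Boundary paths and the components left after removing `M`.

    module _ {M C : Subset n} where

      -- A boundary path is also a path of `G`, so the length of `p` bounds its length; `q` shows
      -- that there is a boundary path to start from.
      ¬¬-boundaryPathLength : ∀ {p q} → IsLongestPath G p → IsBoundaryPath G M C q →
                              ¬ ¬ (∃[ t ] IsBoundaryPathLength G M C t)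
      ¬¬-boundaryPathLength {p} longestPath bp ∄t =
        ¬¬-maximum (IsBoundaryPath G M C) pathLength (pathLength p)
          (λ bp′ → longest _ (toPath (IsPath.nonempty (IsBoundaryPath.isPath bp′))
                               (proj₂ (Path₀-[]⁻ (fromPath (IsBoundaryPath.isPath bp′))))))
          bp
          λ (r , r-bp , maximum) → ∄t (pathLength r , record
            { attained = r , r-bp , refl
            ; bound    = λ _ → maximum
            })
        where open IsLongestPath longestPath

      -- `IsBoundaryPath` allows either endpoint to lie on the boundary, whereas `detour` attaches
      -- at the last vertex; reversal settles the other case.
      orient : ∀ {p} → IsBoundaryPath G M C p →
               ∃[ q ] ∃[ z ] IsPath₀ (G [ C ]) q × length q ≡ length p ×
                             last q ≡ just z × bd G C M z
      orient {p} bp with IsBoundaryPath.boundary bp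
      ... | z , inj₂ last≡z , z∈bd = p , z , fromPath (IsBoundaryPath.isPath bp) , refl , last≡z , z∈bd
      ... | z , inj₁ head≡z , z∈bd =
        reverse p , z , Path₀-reverse (fromPath (IsBoundaryPath.isPath bp)) ,
        length-reverse p , trans (last-reverse p) head≡z , z∈bd

      component-exit : IsComponent (G ∖ M) C → ∀ {u w} → u ∈ C → u ~ w → w ∈ C ⊎ w ∈ M
      component-exit comp {u} {w} u∈C u~w with w ∈? M
      ... | yes w∈M = inj₂ w∈M
      ... | no  w∉M = inj₁ (component-closed (G ∖ M) comp u∈C
        ( proj₂ (x∈p∩q⁻ V (V ─ M) (IsComponent.⊆V comp u∈C))
        , x∈p∧x∉q⇒x∈p─q (~⇒∈V (~-sym u~w)) w∉M , u~w))

      component-∉ : IsComponent (G ∖ M) C → ∀ {u} → u ∈ C → u ∉ M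
      component-∉ comp u∈C = x∈p─q⇒x∉q (proj₂ (x∈p∩q⁻ V (V ─ M) (IsComponent.⊆V comp u∈C)))

      -- A walk from `C` to `x` must leave `C`, as `C` misses `M`. It can leave only into `M`, and
      -- the vertex before that step is on the boundary.
      ¬¬-boundary : Connected G → IsComponent (G ∖ M) C → ∀ {x} → x ∈ V → x ∈ M →
                    ¬ ¬ (∃[ z ] bd G C M z)
      ¬¬-boundary conn comp x∈V x∈M ∄bd with Connected.nonempty (IsComponent.connected comp)
      ... | c , c∈ = component-∉ comp (stay c∈C (Connected⇒Star G conn c∈V x∈V)) x∈M
        where
        c∈C : c ∈ C
        c∈C = proj₂ (x∈p∩q⁻ _ C c∈)

        c∈V : c ∈ V
        c∈V = proj₁ (x∈p∩q⁻ V (V ─ M) (proj₁ (x∈p∩q⁻ _ C c∈)))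

        stay : ∀ {u v} → u ∈ C → Star _~_ u v → v ∈ C
        stay u∈C ε = u∈C
        stay u∈C (u~w ◅ walk) with component-exit comp u∈C u~w
        ... | inj₁ w∈C = stay w∈C walk
        ... | inj₂ w∈M = contradiction (_ , u∈C , _ , w∈M , u~w) ∄bd

-- Longest paths and the set `D ∪ S`.

theorem3p1 : ∀ {n : ℕ} (G : Graph n) (M D Cmax S : Subset n) →
    Connected G →
    IsLongestPathTransversal G M →
    D ⊆ M →
    IsConnectedDominatingSet (G [ M ]) D →
    IsPathMaximal G M Cmax →
    S ⊆ M →
    Dominates G S (bd G Cmax M) →
    IsLongestPathTransversal G (D ∪ S)
theorem3p1 {n} G M D Cmax S G-connected M-transversal D⊆M D-dominating Cmax-maximal S⊆M
           S-dominates = record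
  { ⊆V   = T⊆V
  ; hits = λ p longestPath → decidable-stable (any? (_∈? T) p)
      (missed longestPath ∘ All.¬Any⇒All¬ p)
  }
  where
  open Graph G using (V; _~_; ~-sym; ~⇒∈V)
  open IsPathMaximal Cmax-maximal

  T : Subset n
  T = D ∪ S

  T⊆M : T ⊆ M
  T⊆M v∈T with x∈p∪q⁻ D S v∈T
  ... | inj₁ v∈D = D⊆M v∈D
  ... | inj₂ v∈S = S⊆M v∈S

  T⊆V : T ⊆ V
  T⊆V v∈T = IsLongestPathTransversal.⊆V M-transversal (T⊆M v∈T)

  T-connected : Connected (G [ T ])
  T-connected = ∪-dominated-connected G D⊆M S⊆M D-dominating

  M-sees : ∀ {v} → v ∈ M → v ∉ T → Sees G T v
  M-sees {v} v∈M v∉T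
    with IsConnectedDominatingSet.dominating D-dominating
           (x∈p∩q⁺ (IsLongestPathTransversal.⊆V M-transversal v∈M , v∈M))
  ... | inj₁ v∈D                     = contradiction (p⊆p∪q S v∈D) v∉T
  ... | inj₂ (d , d∈D , _ , _ , v~d) = d , p⊆p∪q S d∈D , v~d

  bd-sees : ∀ {v} → bd G Cmax M v → v ∉ T → Sees G T v
  bd-sees v∈bd v∉T with S-dominates v∈bd
  ... | inj₁ v∈S             = contradiction (q⊆p∪q D S v∈S) v∉T
  ... | inj₂ (s , s∈S , v~s) = s , q⊆p∪q D S s∈S , v~s

  module _ {p} (longestPath : IsLongestPath G p) (p∩T≡∅ : All (_∉ T) p) where
    open IsPath (IsLongestPath.isPath longestPath)

    -- An edge of `p` leaving `Cmax` would join a vertex of `bd G Cmax M` to a vertex of `M`, two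
    -- consecutive vertices that both see `T`. So `p` would lie entirely in `Cmax` and miss the
    -- transversal `M`.
    p-avoids-Cmax : ¬ Any (_∈ Cmax) p
    p-avoids-Cmax meets = All.All¬⇒¬Any (All.map (component-∉ G component) p⊆Cmax)
      (IsLongestPathTransversal.hits M-transversal p longestPath)
      where
      closed : ∀ as {u w} bs → p ≡ as ++ u ∷ w ∷ bs →
               (u ∈ Cmax → w ∈ Cmax) × (w ∈ Cmax → u ∈ Cmax)
      closed as {u} {w} bs refl = forward , backward
        where
        u~w : u ~ w
        u~w = Linked-++-∷⁻ as linked

        not-both : Sees G T u → ¬ Sees G T w
        not-both = consecutive-unseen G T⊆V T-connected longestPath p∩T≡∅ as refl

        u∉T : u ∉ T
        u∉T = All.head (All.++⁻ʳ as p∩T≡∅)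

        w∉T : w ∉ T
        w∉T = All.head (All.tail (All.++⁻ʳ as p∩T≡∅))

        forward : u ∈ Cmax → w ∈ Cmax
        forward u∈C with component-exit G component u∈C u~w
        ... | inj₁ w∈C = w∈C
        ... | inj₂ w∈M = contradiction (M-sees w∈M w∉T)
                           (not-both (bd-sees (u∈C , w , w∈M , u~w) u∉T))

        backward : w ∈ Cmax → u ∈ Cmax
        backward w∈C with component-exit G component w∈C (~-sym u~w)
        ... | inj₁ u∈C = u∈C
        ... | inj₂ u∈M = contradiction (bd-sees (w∈C , u , u∈M , ~-sym u~w) w∉T)
                           (not-both (M-sees u∈M u∉T))

      p⊆Cmax : All (_∈ Cmax) p
      p⊆Cmax = Linked-stable⇒All (Linked-tabulate p closed) meets

    -- After orientation, `q` ends in a vertex that sees `T`, and `x` sees `T` because it lies in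
    -- `M`. As `p` avoids `Cmax`, the path `q` is disjoint from the kept part `x ∷ bs`, so `detour`
    -- applies.
    boundaryPath-shorter : ∀ {as x bs q} → p ≡ as ++ x ∷ bs → x ∈ M →
                           IsBoundaryPath G M Cmax q → length q < length as
    boundaryPath-shorter {as} refl x∈M bp with orient G bp
    ... | r , z , r-path , ∣r∣≡∣q∣ , last≡z , z∈bd = subst (_< length as) ∣r∣≡∣q∣
      (detour G T⊆V T-connected longestPath p∩T≡∅ refl
        (M-sees x∈M (All.head (All.++⁻ʳ as p∩T≡∅)))
        (proj₂ (Path₀-[]⁻ r-path))
        (All.map Cmax∩T≡∅ r⊆Cmax)
        (λ (v∈r , v∈tail) → All.lookup (All.++⁻ʳ as (All.¬Any⇒All¬ p p-avoids-Cmax)) v∈tail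
                              (All.lookup r⊆Cmax v∈r))
        λ last≡z′ → subst (Sees G T) (just-injective (trans (sym last≡z) last≡z′))
          (bd-sees z∈bd (Cmax∩T≡∅ (proj₁ z∈bd))))
      where
      r⊆Cmax : All (_∈ Cmax) r
      r⊆Cmax = proj₁ (Path₀-[]⁻ r-path)

      Cmax∩T≡∅ : ∀ {v} → v ∈ Cmax → v ∉ T
      Cmax∩T≡∅ v∈C v∈T = component-∉ G component v∈C (T⊆M v∈T)

    -- Without a vertex of `M` the prefix cannot leave the component of `a`, and its last vertex is
    -- adjacent to `x` in `M`.
    prefix-boundaryPath : ∀ a as {x bs C} → p ≡ a ∷ as ++ x ∷ bs → All (_∉ M) (a ∷ as) → x ∈ M →
                          IsComponent (G ∖ M) C → a ∈ C → IsBoundaryPath G M C (a ∷ as)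
    prefix-boundaryPath a as {x} {C = C} refl as∩M≡∅ x∈M C-component a∈C
      with Path₀-++⁻ (a ∷ as) (fromPath (IsLongestPath.isPath longestPath)) | last-∷ a as
    ... | as-path , _ , _ , link | z , last≡z = record
      { isPath   = toPath (λ ()) (Path₀-[]⁺ as⊆C as-path)
      ; boundary = z , inj₂ last≡z , All.lookup as⊆C (last⇒∈ (a ∷ as) last≡z) , x , x∈M ,
                   Link.drop-just (subst (λ l → Link _~_ l (just x)) last≡z link)
      }
      where
      stays : ∀ {u w} → w ∉ M → u ~ w → u ∈ C → w ∈ C
      stays w∉M u~w u∈C with component-exit G C-component u∈C u~w
      ... | inj₁ w∈C = w∈C
      ... | inj₂ w∈M = contradiction w∈M w∉M

      as⊆C : All (_∈ C) (a ∷ as)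
      as⊆C = Linked-stable⇒All
        (Linked.map (λ (u∉M , w∉M , u~w) → stays w∉M u~w , stays u∉M (~-sym u~w))
          (Linked-restrict as∩M≡∅ (IsPath₀.linked as-path)))
        (here a∈C)

  missed : ∀ {p} → IsLongestPath G p → ¬ All (_∉ T) p
  missed {p} longestPath p∩T≡∅
    -- This looks for the first vertex of `p` in `M`; the swap makes non-membership in `M` the
    -- property of the vertices passed over.
    with First.first (Sum.swap ∘ toSum ∘ (_∈? M)) p
  ... | inj₂ p∩M≡∅ =
    All.All¬⇒¬Any p∩M≡∅ (IsLongestPathTransversal.hits M-transversal p longestPath)
  ... | inj₁ first with toView first
  ...   | First._++_∷_ {[]} _ x∈M bs =
    head-unseen G T⊆V T-connected longestPath p∩T≡∅ refl (M-sees x∈M (All.head p∩T≡∅))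
  ...   | First._++_∷_ {a ∷ as} {x} as∩M≡∅ x∈M bs =
    -- The goal is the empty type, so the doubly negated existence statements can be opened one
    -- after another: a boundary vertex of `Cmax`, then `tmax`, the component of `a`, and its `t`.
    ¬¬-boundary G G-connected component (IsLongestPathTransversal.⊆V M-transversal x∈M) x∈M
      λ (z , z∈bd) →
    ¬¬-boundaryPathLength G longestPath (singleton z∈bd)
      λ (tmax , isTmax) →
    ¬¬-component (G ∖ M) (x∈p∩q⁺ (a∈V , x∈p∧x∉q⇒x∈p─q a∈V (All.head as∩M≡∅)))
      λ (C , C-component , a∈C) →
    let prefix = prefix-boundaryPath longestPath p∩T≡∅ a as refl as∩M≡∅ x∈M C-component a∈C in
    ¬¬-boundaryPathLength G longestPath prefix
      λ (t , isT) →
    too-short isTmax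
      (≤-trans (IsBoundaryPathLength.bound isT _ prefix) (maximal isTmax C-component isT))
    where
    a∈V : a ∈ V
    a∈V = All.head (IsPath.inV (IsLongestPath.isPath longestPath))

    -- A single boundary vertex guarantees that `Cmax` has a boundary path at all, so that `tmax` is
    -- available.
    singleton : ∀ {z} → bd G Cmax M z → IsBoundaryPath G M Cmax (z ∷ [])
    singleton z∈bd@(z∈C , _ , _ , z~y) = record
      { isPath   = toPath (λ ()) (mkPath₀ (x∈p∩q⁺ (~⇒∈V z~y , z∈C) ∷ []) [-] ([] ∷ []))
      ; boundary = _ , inj₁ refl , z∈bd
      }

    -- The value `tmax` is attained by some `q`, which would then have at least as many vertices as
    -- the prefix, against the strict bound of `boundaryPath-shorter`.
    too-short : ∀ {tmax} → IsBoundaryPathLength G M Cmax tmax → ¬ pathLength (a ∷ as) ≤ tmax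
    too-short isTmax ∣as∣≤tmax with IsBoundaryPathLength.attained isTmax
    ... | q , q-bp , refl = <⇒≱ (boundaryPath-shorter longestPath p∩T≡∅ refl x∈M q-bp)
      (pathLength⇒length (a ∷ as) q (IsPath.nonempty (IsBoundaryPath.isPath q-bp)) ∣as∣≤tmax)
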